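{- Let $n\ge 1$, let $a=(a_1,\ldots,a_n)$ and $b=(b_1,\ldots,b_n)$ be two $n$-tuples of positive integers, and let $X\subseteq\mathbb{N}$. Let $S\in\mathcal{N}(a,b,X)$ and let $m\in\mathrm{msg}(S)$. Then $S\setminus\{m\}\in\mathcal{N}(a,b,X)$ if and only if $\frac{m-b_i}{a_i}\notin S\setminus\{0\}$ for all $i\in\{1,\ldots,n\}$ and $m\notin X$.
   Context: $\mathbb{N}$ is the set of non-negative integers. A numerical semigroup is a submonoid $S$ of $(\mathbb{N},+)$ with $\mathbb{N}\setminus S$ finite. $\mathrm{msg}(S)$ denotes the (unique) minimal system of generators of $S$, i.e. $\mathrm{msg}(S)=(S\setminus\{0\})\setminus\big((S\setminus\{0\})+(S\setminus\{0\})\big)$. For $s\in\mathbb{N}$, $as+b=(a_1s+b_1,\ldots,a_ns+b_n)$. $\mathcal{N}(a,b,X)$ is the set of all numerical semigroups $S$ such that $X\subseteq S$ and $as+b\in S^n$ for all $s\in S\setminus\{0\}$. The quotient $\frac{m-b_i}{a_i}$ is a rational number (it may fail to be an integer or be negative, in which case it is not in $S\setminus\{0\}$). -}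

module Defs where

open import Level using (Level; _⊔_)
open import Data.Nat.Base using (ℕ; _+_; _*_)
open import Data.Integer.Base using (+_)
open import Data.Rational.Base using (ℚ; _/_)
open import Data.List.Base using (List)
import Data.List.Membership.Propositional as List
open import Data.Product.Base using (∃-syntax; _×_)
open import Data.Vec.Functional using (Vector)
open import Data.Vec.Functional.Relation.Unary.All using (All)
open import Relation.Unary using (Pred; _∈_; _⊆_; _≐_; _∖_; ∁; ｛_｝)
open import Relation.Binary.PropositionalEquality.Core using (_≡_)

private
  variable
    a p q : Level

-- Constructively there are several inequivalent notions of finite subset;
-- here a finite subset is one whose elements are exactly those of some list.
Finite : {A : Set a} → Pred A p → Set (a ⊔ p)
Finite {A = A} P = ∃[ xs ] P ≐ (λ (x : A) → x List.∈ xs)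

-- Subsets of ℕ are arbitrary predicates: membership is not assumed decidable.
record IsNumericalSemigroup (S : Pred ℕ p) : Set p where
  field
    0∈S      : 0 ∈ S
    +-closed : ∀ {x y} → x ∈ S → y ∈ S → x + y ∈ S
    cofinite : Finite (∁ S)

infixl 6 _⊕_

_⊕_ : Pred ℕ p → Pred ℕ q → Pred ℕ (p ⊔ q)
(P ⊕ Q) z = ∃[ x ] ∃[ y ] x ∈ P × y ∈ Q × z ≡ x + y

infix 8 _*

_* : Pred ℕ p → Pred ℕ p
S * = S ∖ ｛ 0 ｝

msg : Pred ℕ p → Pred ℕ p
msg S = S * ∖ (S * ⊕ S *)

infix 5 _·_⊞_

_·_⊞_ : ∀ {n} → Vector ℕ n → ℕ → Vector ℕ n → Vector ℕ n
(a · s ⊞ b) i = a i * s + b i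

-- All S v expresses v ∈ Sⁿ.
record 𝒩 {n} (a b : Vector ℕ n) (X : Pred ℕ q) (S : Pred ℕ p) : Set (p ⊔ q) where
  field
    isNumericalSemigroup : IsNumericalSemigroup S
    X⊆S                  : X ⊆ S
    affine-closed        : ∀ s → s ∈ S * → All S (a · s ⊞ b)

-- The image of a subset of ℕ under the inclusion ℕ ⊆ ℚ.
asRationals : Pred ℕ p → Pred ℚ p
asRationals P r = ∃[ s ] s ∈ P × r ≡ + s / 1

{-# OPTIONS --safe #-}
module Submission where

open import Defs
open import Level using (Level)
open import Algebra.Bundles using (AbelianGroup)
open import Algebra.Properties.Group using (//-rightDividesˡ; //-rightDividesʳ)
open import Data.Nat.Base using (ℕ; zero; suc; _+_; _*_; _≤_; _<_; NonZero; >-nonZero)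
open import Data.Nat.Properties using (_≟_; +-identityʳ; *-comm; m≤n*m; m<m+n; <-irrefl; module ≤-Reasoning)
open import Data.Integer.Base as ℤ using (+_; _-_)
import Data.Integer.Properties as ℤ
open import Data.List.Base using (_∷_)
import Data.List.Membership.Propositional as List
open import Data.List.Relation.Unary.Any using (here; there)
open import Data.Rational.Base using (_/_)
import Data.Rational.Properties as ℚ
open import Data.Rational.Unnormalised.Base using (mkℚᵘ; *≡*)
open import Data.Product.Base using (_×_; _,_; proj₁; proj₂)
open import Data.Vec.Functional using (Vector)
open import Function.Base using (_∘_)
open import Function.Bundles using (_⇔_; mk⇔)
open import Relation.Binary.PropositionalEquality
  using (_≡_; _≢_; refl; sym; trans; cong; subst; module ≡-Reasoning)
open import Relation.Nullary using (yes; no)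
open import Relation.Unary using (Pred; _∈_; _∉_; _∖_; ∁; ｛_｝)

-- Removing a minimal generator `m` always leaves a numerical semigroup: `m` is not a sum of two
-- nonzero elements of `S`, and the complement grows by one point. So only the other two conditions
-- of `𝒩` can fail. The inclusion of `X` fails exactly when `m ∈ X`. Affine closure fails exactly
-- when some nonzero `s` in `S ∖ ｛ m ｝` satisfies `a i * s + b i ≡ m`, that is, `(m - b i) / a i`
-- equals `s`. Letting `s` range over all of `S *` changes nothing, because `a i * s + b i` exceeds
-- `s` and so `s ≡ m` cannot occur.

private
  variable
    p : Level

  ℤ-group = AbelianGroup.group ℤ.+-0-abelianGroup

[m-b]/a≡s⇒m≡a*s+b : ∀ m a b s .{{_ : NonZero a}} →
                    (+ m - + b) / a ≡ + s / 1 → m ≡ a * s + b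
[m-b]/a≡s⇒m≡a*s+b m a@(suc k) b s eq
  -- With `a` matched as `suc k`, both sides are `fromℚᵘ` of explicit fractions; `mkℚᵘ` stores the
  -- denominator minus one, hence `k` and `0`. Cross-multiplying gives an equation in ℤ, where
  -- `m - b` is not truncated.
  with *≡* cross ← ℚ.fromℚᵘ-injective {mkℚᵘ (+ m - + b) k} {mkℚᵘ (+ s) 0} eq =
  ℤ.+-injective (begin
    + m                         ≡⟨ //-rightDividesˡ ℤ-group (+ b) (+ m) ⟨
    (+ m - + b) ℤ.+ + b         ≡⟨ cong (ℤ._+ + b) (ℤ.*-identityʳ (+ m - + b)) ⟨
    (+ m - + b) ℤ.* + 1 ℤ.+ + b ≡⟨ cong (ℤ._+ + b) cross ⟩
    + s ℤ.* + a ℤ.+ + b         ≡⟨ cong (ℤ._+ + b) (ℤ.pos-* s a) ⟨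
    + (s * a + b)               ≡⟨ cong (λ x → + (x + b)) (*-comm s a) ⟩
    + (a * s + b)               ∎)
  where open ≡-Reasoning

[a*s+b-b]/a≡s : ∀ a b s .{{_ : NonZero a}} →
                (+ (a * s + b) - + b) / a ≡ + s / 1
[a*s+b-b]/a≡s a@(suc k) b s =
  ℚ.fromℚᵘ-cong {mkℚᵘ (+ (a * s + b) - + b) k} {mkℚᵘ (+ s) 0} (*≡* (begin
    (+ (a * s + b) - + b) ℤ.* + 1 ≡⟨ ℤ.*-identityʳ _ ⟩
    + (a * s + b) - + b           ≡⟨ //-rightDividesʳ ℤ-group (+ b) (+ (a * s)) ⟩
    + (a * s)                     ≡⟨ cong +_ (*-comm a s) ⟩
    + (s * a)                     ≡⟨ ℤ.pos-* s a ⟩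
    + s ℤ.* + a                   ∎))
  where open ≡-Reasoning

s<a*s+b : ∀ a b s .{{_ : NonZero a}} → 0 < b → s < a * s + b
s<a*s+b a b s b>0 = begin-strict
  s         ≤⟨ m≤n*m s a ⟩
  a * s     <⟨ m<m+n (a * s) b>0 ⟩
  a * s + b ∎
  where open ≤-Reasoning

-- If `x + y` were `m` with `x` and `y` in `S` and different from `m`, neither could be zero, since
-- the other would then be `m`; so `m` would decompose in `S *`. The gaps are those of `S` together
-- with `m`.
∖-msg-isNumericalSemigroup : {S : Pred ℕ p} {m : ℕ} → IsNumericalSemigroup S →
                             m ∈ msg S → IsNumericalSemigroup (S ∖ ｛ m ｝)
∖-msg-isNumericalSemigroup {S = S} {m} isNS ((_ , 0≢m) , indecomposable) = record
  { 0∈S      = 0∈S , 0≢m ∘ sym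
  ; +-closed = λ (x∈S , m≢x) (y∈S , m≢y) → +-closed x∈S y∈S , m≢x+y x∈S m≢x y∈S m≢y
  ; cofinite = m ∷ gaps , gaps-complete , gaps-sound
  }
  where
  open IsNumericalSemigroup isNS
  gaps = proj₁ cofinite

  m≢x+y : ∀ {x y} → x ∈ S → m ≢ x → y ∈ S → m ≢ y → m ≢ x + y
  m≢x+y {zero}             x∈S m≢x y∈S m≢y m≡x+y = m≢y m≡x+y
  m≢x+y {x@(suc _)} {zero} x∈S m≢x y∈S m≢y m≡x+y = m≢x (trans m≡x+y (+-identityʳ x))
  m≢x+y {suc _} {suc _}    x∈S m≢x y∈S m≢y m≡x+y =
    indecomposable (_ , _ , (x∈S , λ ()) , (y∈S , λ ()) , m≡x+y)

  gaps-complete : ∀ {x} → x ∈ ∁ (S ∖ ｛ m ｝) → x List.∈ m ∷ gaps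
  -- Membership in `S` need not be decidable, so the split is on equality with `m`. When `m ≢ x`,
  -- having `x ∈ S` would put `x` in `S ∖ ｛ m ｝`, so `x` is a gap of `S`.
  gaps-complete {x} x∉S∖m with m ≟ x
  ... | yes m≡x = here (sym m≡x)
  ... | no  m≢x = there (proj₁ (proj₂ cofinite) λ x∈S → x∉S∖m (x∈S , m≢x))

  gaps-sound : ∀ {x} → x List.∈ m ∷ gaps → x ∈ ∁ (S ∖ ｛ m ｝)
  gaps-sound (here x≡m)     (_   , m≢x) = m≢x (sym x≡m)
  gaps-sound (there x∈gaps) (x∈S , _)   = proj₂ (proj₂ cofinite) x∈gaps x∈S

proposition3p2 : ∀ {p q : Level} (n : ℕ) → 1 ≤ n →
    (a b : Vector ℕ n) (a>0 : ∀ i → 0 < a i) → (∀ i → 0 < b i) →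
    (X : Pred ℕ q) (S : Pred ℕ p) → S ∈ 𝒩 a b X →
    (m : ℕ) → m ∈ msg S →
    (S ∖ ｛ m ｝ ∈ 𝒩 a b X) ⇔
    ((∀ i → ((+ m - + b i) / a i) {{ >-nonZero (a>0 i) }} ∉ asRationals (S *)) × m ∉ X)
proposition3p2 n _ a b a>0 b>0 X S S∈𝒩 m m∈msg = mk⇔ to from
  where
  open 𝒩
  quotients∉S* = ∀ i → ((+ m - + b i) / a i) {{ >-nonZero (a>0 i) }} ∉ asRationals (S *)

  to : S ∖ ｛ m ｝ ∈ 𝒩 a b X → quotients∉S* × m ∉ X
  to S∖m∈𝒩 = quotient∉S* , λ m∈X → proj₂ (X⊆S S∖m∈𝒩 m∈X) refl
    where
    quotient∉S* : quotients∉S*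
    quotient∉S* i (s , (s∈S , 0≢s) , eq) =
      -- Closure of the smaller set applies to `s` only once `s` is known to differ from `m`; it
      -- then forces `a i * s + b i` to differ from `m` too.
      proj₂ (affine-closed S∖m∈𝒩 s ((s∈S , m≢s) , 0≢s) i) m≡as+b
      where
      instance _ = >-nonZero (a>0 i)
      m≡as+b = [m-b]/a≡s⇒m≡a*s+b m (a i) (b i) s eq
      m≢s : m ≢ s
      m≢s m≡s = <-irrefl (trans (sym m≡s) m≡as+b) (s<a*s+b (a i) (b i) s (b>0 i))

  from : quotients∉S* × m ∉ X → S ∖ ｛ m ｝ ∈ 𝒩 a b X
  from (quotient∉S* , m∉X) = record
    { isNumericalSemigroup = ∖-msg-isNumericalSemigroup (isNumericalSemigroup S∈𝒩) m∈msg
    ; X⊆S = λ x∈X → X⊆S S∈𝒩 x∈X , λ m≡x → m∉X (subst X (sym m≡x) x∈X)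
    ; affine-closed = λ s ((s∈S , _) , 0≢s) i →
        affine-closed S∈𝒩 s (s∈S , 0≢s) i , m≢as+b s (s∈S , 0≢s) i
    }
    where
    m≢as+b : ∀ s → s ∈ S * → ∀ i → m ≢ a i * s + b i
    -- Matching `refl` replaces `m` by `a i * s + b i`, so the forbidden quotient evaluates to `s`
    -- itself.
    m≢as+b s s∈S* i refl =
      quotient∉S* i (s , s∈S* , [a*s+b-b]/a≡s (a i) (b i) s {{ >-nonZero (a>0 i) }})
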